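{- Let $N\in\mathbb{N}$ be odd and either prime or divisible by at least two distinct primes. Let $b\in\mathbb{Z}$ and $f\in\mathbb{Z}[X]$ with $f(b)=N$, let $d:=\deg f$, and suppose $d$ is smaller than $q:=\max\{q'\text{ prime}:q'\mid N\}$ and $\gcd(\mathrm{lc}(f),N)=1$, where $\mathrm{lc}(f)$ is the leading coefficient of $f$. Then \[N\text{ is prime}\iff \forall x\in\{0,\dots,N-1\}:\ f(x)^{N-1}\bmod N\in\{0,1\}.\] -}

module Defs where

open import Data.Bool.Base using (if_then_else_)
open import Data.Integer.Base using (ℤ; 0ℤ; _+_; _*_)
open import Data.Integer.Properties using (_≟_)
open import Data.List.Base using (List; []; _∷_)
open import Data.Nat.Base as ℕ using (ℕ; suc)
open import Data.Nat.Divisibility using (_∣_)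
open import Data.Nat.Primality using (Prime)
open import Data.Product.Base using (_×_; ∃₂)
open import Relation.Binary.PropositionalEquality.Core using (_≢_)
open import Relation.Nullary.Decidable.Core using (⌊_⌋)
open import Relation.Nullary.Negation.Core using (¬_)

Odd : ℕ → Set
Odd n = ¬ (2 ∣ n)

HasTwoDistinctPrimeDivisors : ℕ → Set
HasTwoDistinctPrimeDivisors n =
  ∃₂ λ p r → Prime p × Prime r × p ≢ r × p ∣ n × r ∣ n

IsLargestPrimeDivisor : ℕ → ℕ → Set
IsLargestPrimeDivisor q n =
  Prime q × q ∣ n × (∀ p → Prime p → p ∣ n → p ℕ.≤ q)

-- The list a₀ ∷ a₁ ∷ … ∷ aₙ ∷ [] stands for a₀ + a₁X + … + aₙXⁿ.  Trailing
-- zeros are allowed, so a polynomial has many representations; eval, lc and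
-- deg do not depend on the choice.
ℤ[X] : Set
ℤ[X] = List ℤ

eval : ℤ[X] → ℤ → ℤ
eval []      x = 0ℤ
eval (a ∷ f) x = a + x * eval f x

-- The last nonzero coefficient.  Only the zero polynomial has lc f ≡ 0ℤ.
lc : ℤ[X] → ℤ
lc []      = 0ℤ
lc (a ∷ f) = if ⌊ lc f ≟ 0ℤ ⌋ then a else lc f

-- The index of the last nonzero coefficient.  The zero polynomial gets the
-- junk value 0.
deg : ℤ[X] → ℕ
deg []      = 0
deg (a ∷ f) = if ⌊ lc f ≟ 0ℤ ⌋ then 0 else suc (deg f)

{-# OPTIONS --safe #-}
-- The forward direction is Fermat's little theorem.  Conversely, let N have two
-- distinct prime divisors, and let p be one of them other than q.  For any i choose
-- x with x ≡ b mod p and x ≡ i mod q.  Then p ∣ f(b) gives p ∣ f(x), so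
-- f(x) ^ (N - 1) is not 1 mod N; hence it is 0, which gives q ∣ f(x) and then
-- q ∣ f(i).  So f vanishes identically mod q, and as deg f < q, its leading
-- coefficient is divisible by q, contradicting gcd (lc f) N = 1.
module Submission where

open import Defs
open import Data.Integer.Base
  using (ℤ; +_; 0ℤ; 1ℤ; ∣_∣; _+_; _-_; -_; _*_; _^_; _%ℕ_; _/ℕ_; _⊖_)
open import Data.Integer.GCD using (gcd; gcd-greatest)
open import Data.Nat.Base as ℕ
  using (ℕ; zero; suc; NonZero; _∸_; _!; _≤_; _<_; z≤n; s≤s; z<s; s<s)
open import Data.Nat.Primality
  using (Prime; euclidsLemma; prime⇒irreducible; prime⇒nonZero; prime⇒nonTrivial;
         ¬prime[0]; ¬prime[1])
open import Data.Sum.Base as Sum using (_⊎_; inj₁; inj₂; [_,_]′)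
open import Function.Bundles using (_⇔_; mk⇔)
open import Relation.Binary.PropositionalEquality
  using (_≡_; _≢_; refl; sym; trans; cong; cong₂; subst; module ≡-Reasoning)

open import Data.Fin.Base as Fin using (toℕ; fromℕ; inject₁)
open import Data.Fin.Properties using (toℕ-fromℕ; inject₁ℕ<)
open import Data.Integer.Divisibility.Signed as Signed
  using (_∣_; ∣⇒∣ᵤ; ∣ᵤ⇒∣; ∣-trans; ∣m∣n⇒∣m+n; ∣m∣n⇒∣m-n; ∣m⇒∣-m; ∣n⇒∣m*n; ∣m⇒∣m*n)
open import Data.Integer.DivMod using (a≡a%ℕn+[a/ℕn]*n; n%ℕd<d)
open import Data.Integer.Properties as ℤ
  using (+-*-commutativeSemiring; +-*-semiring; +-0-monoid)
open import Data.Integer.Tactic.RingSolver using (solve-∀)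
open import Data.List.Base using ([]; _∷_)
open import Data.Nat.Combinatorics
  using (_C_; nCn≡1; nCk≡nC[n∸k]; nCk≡n!/k![n-k]!; k![n∸k]!∣n!)
open import Data.Nat.Divisibility as ℕ∣ using ()
open import Data.Nat.DivMod using (m/n*n≡m)
open import Data.Nat.Properties as ℕ using (_!*_!≢0)
open import Data.Product.Base using (_×_; _,_; Σ-syntax; ∃-syntax)
open import Data.Vec.Base using (Vec; []; _∷_)
open import Data.Vec.Functional using (Vector)
open import Function.Base using (_∘_; id)
open import Relation.Nullary using (¬_; yes; no; contradiction)

open import Algebra.Properties.Monoid.Sum +-0-monoid using (sum; sum-init-last)
open import Algebra.Properties.Semiring.Mult +-*-semiring using () renaming (_×_ to _·_)
open import Algebra.Properties.Semiring.Exp +-*-semiring using () renaming (_^_ to _^′_)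
open import Algebra.Properties.CommutativeSemiring.Binomial +-*-commutativeSemiring
  using (binomialTerm) renaming (theorem to binomialTheorem)

-- Congruences

infix 4 _≡_[mod_]

-- A record rather than a synonym, so that unification can read `x` and `y` off the type; they
-- cannot be recovered from the value of `x - y`.
record _≡_[mod_] (x y : ℤ) (m : ℕ) : Set where
  constructor mod
  field difference : + m ∣ x - y

open _≡_[mod_]

private variable
  m n p q : ℕ
  w x y z : ℤ

mod-reflexive : x ≡ y → x ≡ y [mod m ]
mod-reflexive {x} refl = mod (Signed.divides 0ℤ (ℤ.+-inverseʳ x))

mod-refl : ∀ x → x ≡ x [mod m ]
mod-refl x = mod-reflexive refl

mod-sym : x ≡ y [mod m ] → y ≡ x [mod m ]
mod-sym {x} {y} {m} (mod d) = mod (subst (+ m ∣_) (negate x y) (∣m⇒∣-m d))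
  where
  negate : ∀ x y → - (x - y) ≡ y - x
  negate = solve-∀

mod-trans : x ≡ y [mod m ] → y ≡ z [mod m ] → x ≡ z [mod m ]
mod-trans {x} {y} {m} {z} (mod d) (mod e) =
  mod (subst (+ m ∣_) (telescope x y z) (∣m∣n⇒∣m+n d e))
  where
  telescope : ∀ x y z → (x - y) + (y - z) ≡ x - z
  telescope = solve-∀

+-mod : w ≡ x [mod m ] → y ≡ z [mod m ] → w + y ≡ x + z [mod m ]
+-mod {w} {x} {m} {y} {z} (mod d) (mod e) =
  mod (subst (+ m ∣_) (regroup w x y z) (∣m∣n⇒∣m+n d e))
  where
  regroup : ∀ w x y z → (w - x) + (y - z) ≡ (w + y) - (x + z)
  regroup = solve-∀

*-mod : w ≡ x [mod m ] → y ≡ z [mod m ] → w * y ≡ x * z [mod m ]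
*-mod {w} {x} {m} {y} {z} (mod d) (mod e) =
  mod (subst (+ m ∣_) (regroup w x y z) (∣m∣n⇒∣m+n (∣m⇒∣m*n y d) (∣n⇒∣m*n x e)))
  where
  regroup : ∀ w x y z → (w - x) * y + x * (y - z) ≡ w * y - x * z
  regroup = solve-∀

^-mod : ∀ k → x ≡ y [mod m ] → x ^ k ≡ y ^ k [mod m ]
^-mod zero    c = mod-refl 1ℤ
^-mod (suc k) c = *-mod c (^-mod k c)

eval-mod : ∀ f → x ≡ y [mod m ] → eval f x ≡ eval f y [mod m ]
eval-mod []      c = mod-refl 0ℤ
eval-mod (a ∷ f) c = +-mod (mod-refl a) (*-mod c (eval-mod f c))

∣⇒≡0 : + m ∣ x → x ≡ 0ℤ [mod m ]
∣⇒≡0 {m} {x} d = mod (subst (+ m ∣_) (sym (ℤ.+-identityʳ x)) d)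

≡0⇒∣ : x ≡ 0ℤ [mod m ] → + m ∣ x
≡0⇒∣ {x} {m} (mod d) = subst (+ m ∣_) (ℤ.+-identityʳ x) d

mod-∣ : m ℕ∣.∣ n → x ≡ y [mod n ] → x ≡ y [mod m ]
mod-∣ m∣n (mod d) = mod (∣-trans (∣ᵤ⇒∣ m∣n) d)

≡%ℕ : ∀ z n .{{_ : NonZero n}} → z ≡ + (z %ℕ n) [mod n ]
≡%ℕ z n = mod (Signed.divides (z /ℕ n) (begin
  z - + (z %ℕ n)                                    ≡⟨ cong (_- + (z %ℕ n)) (a≡a%ℕn+[a/ℕn]*n z n) ⟩
  + (z %ℕ n) + (z /ℕ n) * + n - + (z %ℕ n)          ≡⟨ cancel (+ (z %ℕ n)) _ ⟩
  (z /ℕ n) * + n                                    ∎))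
  where
  open ≡-Reasoning
  cancel : ∀ r s → r + s - r ≡ s
  cancel = solve-∀

-- The distance between `i` and `j` is at most their maximum, hence below `n`, and the only multiple
-- of `n` below `n` is 0.
distinctResidues : ∀ {i j} → i < n → j < n → + i ≡ + j [mod n ] → i ≡ j
distinctResidues {n} {i} {j} i<n j<n (mod d) =
  ℤ.+-injective (ℤ.i-j≡0⇒i≡j (+ i) (+ j)
    (trans (ℤ.[+m]-[+n]≡m⊖n i j) (ℤ.∣i∣≡0⇒i≡0 (zeroMultiple ∣i-j∣<n n∣∣i-j∣))))
  where
  ∣i-j∣<n : ∣ i ⊖ j ∣ < n
  ∣i-j∣<n = ℕ.≤-<-trans (ℤ.∣m⊝n∣≤m⊔n i j) (ℕ.⊔-lub i<n j<n)

  n∣∣i-j∣ : n ℕ∣.∣ ∣ i ⊖ j ∣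
  n∣∣i-j∣ = subst (λ z → n ℕ∣.∣ ∣ z ∣) (ℤ.[+m]-[+n]≡m⊖n i j) (∣⇒∣ᵤ d)

  zeroMultiple : ∀ {k} → k < n → n ℕ∣.∣ k → k ≡ 0
  zeroMultiple {zero}  _   _   = refl
  zeroMultiple {suc k} k<n n∣k = contradiction n∣k (ℕ∣.>⇒∤ k<n)

%ℕ-unique : ∀ {r} .{{_ : NonZero n}} → r < n → z ≡ + r [mod n ] → z %ℕ n ≡ r
%ℕ-unique {n} {z} r<n c = distinctResidues (n%ℕd<d z n) r<n (mod-trans (mod-sym (≡%ℕ z n)) c)

-- Prime divisors

prime∣* : Prime p → ∀ x y → + p ∣ x * y → (+ p ∣ x) ⊎ (+ p ∣ y)
prime∣* pr x y d = Sum.map ∣ᵤ⇒∣ ∣ᵤ⇒∣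
  (euclidsLemma ∣ x ∣ ∣ y ∣ pr (subst (_ ℕ∣.∣_) (ℤ.abs-* x y) (∣⇒∣ᵤ d)))

prime∤1 : Prime p → ¬ p ℕ∣.∣ 1
prime∤1 pr p∣1 = ¬prime[1] (subst Prime (ℕ∣.∣1⇒≡1 p∣1) pr)

prime∣^ : Prime p → ∀ x k → + p ∣ x ^ k → + p ∣ x
prime∣^ pr x zero    d = contradiction (∣⇒∣ᵤ d) (prime∤1 pr)
prime∣^ pr x (suc k) d = [ id , prime∣^ pr x k ]′ (prime∣* pr x (x ^ k) d)

prime∣prime : Prime p → Prime q → p ℕ∣.∣ q → p ≡ q
prime∣prime pp pq p∣q with prime⇒irreducible pq p∣q
... | inj₁ p≡1 = contradiction (subst Prime p≡1 pp) ¬prime[1]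
... | inj₂ p≡q = p≡q

prime∤! : Prime p → ∀ {k} → k < p → ¬ p ℕ∣.∣ k !
prime∤! pr {zero}  k<p d = prime∤1 pr d
prime∤! pr {suc k} k<p d with euclidsLemma (suc k) (k !) pr d
... | inj₁ p∣1+k = ℕ∣.>⇒∤ k<p p∣1+k
... | inj₂ p∣k!  = prime∤! pr (ℕ.<-trans (ℕ.n<1+n k) k<p) p∣k!

-- `p` divides `p !`, which is `p C k` times `k !` times `(p ∸ k) !`. Both factorials have arguments
-- below `p`, so neither absorbs the prime; `0 < k` is what makes `p ∸ k` smaller than `p`.
prime∣C : Prime p → ∀ {k} → 0 < k → k < p → p ℕ∣.∣ p C k
prime∣C {p@(suc p-1)} pr {k} 0<k k<p
  with euclidsLemma (p C k) (k ! ℕ.* (p ∸ k) !) pr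
         (subst (p ℕ∣.∣_) (sym C*k!*[p-k]!≡p!) (ℕ∣.m∣m*n (p-1 !)))
  where
  instance _ = k !* (p ∸ k) !≢0

  C*k!*[p-k]!≡p! : (p C k) ℕ.* (k ! ℕ.* (p ∸ k) !) ≡ p !
  C*k!*[p-k]!≡p! = trans (cong (ℕ._* (k ! ℕ.* (p ∸ k) !)) (nCk≡n!/k![n-k]! (ℕ.<⇒≤ k<p)))
                         (m/n*n≡m (k![n∸k]!∣n! (ℕ.<⇒≤ k<p)))
... | inj₁ p∣C = p∣C
... | inj₂ p∣d with euclidsLemma (k !) ((p ∸ k) !) pr p∣d
...   | inj₁ p∣k! = contradiction p∣k! (prime∤! pr k<p)
...   | inj₂ p∣[p-k]! = contradiction p∣[p-k]!
          (prime∤! pr (ℕ.∸-monoʳ-< 0<k (ℕ.<⇒≤ k<p)))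
prime∣C {zero} pr = contradiction pr ¬prime[0]

-- Fermat's little theorem

-- The binomial theorem speaks of powers and natural multiples in an arbitrary semiring; this lemma
-- and the next translate them into integer operations.
^′≡^ : ∀ x k → x ^′ k ≡ x ^ k
^′≡^ x zero    = refl
^′≡^ x (suc k) = cong (x *_) (^′≡^ x k)

·≡* : ∀ k x → k · x ≡ + k * x
·≡* zero    x = sym (ℤ.*-zeroˡ x)
·≡* (suc k) x = trans (cong (_+_ x) (·≡* k x)) (sym (ℤ.suc-* (+ k) x))

∣⇒·≡0 : ∀ {k} → m ℕ∣.∣ k → ∀ x → k · x ≡ 0ℤ [mod m ]
∣⇒·≡0 {m} {k} m∣k x =
  ∣⇒≡0 (subst (+ m ∣_) (sym (·≡* k x)) (∣m⇒∣m*n {i = + m} {m = + k} x (∣ᵤ⇒∣ m∣k)))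

sum≡0 : (t : Vector ℤ n) → (∀ i → t i ≡ 0ℤ [mod m ]) → sum t ≡ 0ℤ [mod m ]
sum≡0 {zero}  t c = mod-refl 0ℤ
sum≡0 {suc n} t c = +-mod (c Fin.zero) (sum≡0 (t ∘ Fin.suc) (c ∘ Fin.suc))

-- In the binomial expansion every term except the two outermost has a coefficient divisible by `p`.
^-+-mod : Prime p → ∀ x y → (x + y) ^ p ≡ x ^ p + y ^ p [mod p ]
^-+-mod {zero}       pr x y = contradiction pr ¬prime[0]
^-+-mod {p@(suc p-1)} pr x y =
  mod-trans (mod-reflexive expansion)
  (mod-trans (+-mod (mod-refl (x ^ p + y ^ p)) inner≡0)
             (mod-reflexive (ℤ.+-identityʳ (x ^ p + y ^ p))))
  where
  term : Vector ℤ (suc p)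
  term = binomialTerm x y p

  innerTerm : Vector ℤ p-1
  innerTerm i = term (Fin.suc (inject₁ i))

  -- The term of index k carries the k-th power of `x`, so index 0 yields the power of `y`. The
  -- summand `0ℤ` below comes from unfolding the multiple `1 · z` to `z + 0ℤ`.
  firstTerm : term Fin.zero ≡ y ^ p
  firstTerm = begin
    (p C 0) · (1ℤ * y ^′ p)  ≡⟨ cong (_· (1ℤ * y ^′ p)) (trans (nCk≡nC[n∸k] {0} {p} z≤n) (nCn≡1 p)) ⟩
    1ℤ * y ^′ p + 0ℤ         ≡⟨ ℤ.+-identityʳ _ ⟩
    1ℤ * y ^′ p              ≡⟨ ℤ.*-identityˡ _ ⟩
    y ^′ p                   ≡⟨ ^′≡^ y p ⟩
    y ^ p                    ∎
    where open ≡-Reasoning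

  lastTerm : term (Fin.suc (fromℕ p-1)) ≡ x ^ p
  lastTerm rewrite toℕ-fromℕ p-1 = begin
    (p C p) · (x ^′ p * y ^′ (p-1 ∸ p-1)) ≡⟨ cong₂ (λ c e → c · (x ^′ p * y ^′ e)) (nCn≡1 p) (ℕ.n∸n≡0 p-1) ⟩
    x ^′ p * 1ℤ + 0ℤ         ≡⟨ ℤ.+-identityʳ _ ⟩
    x ^′ p * 1ℤ              ≡⟨ ℤ.*-identityʳ _ ⟩
    x ^′ p                   ≡⟨ ^′≡^ x p ⟩
    x ^ p                    ∎
    where open ≡-Reasoning

  inner≡0 : sum innerTerm ≡ 0ℤ [mod p ]
  inner≡0 = sum≡0 innerTerm λ i →
    ∣⇒·≡0 (prime∣C pr {suc (toℕ (inject₁ i))} z<s (s<s (inject₁ℕ< i))) _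

  rotate : ∀ a b c → a + (b + c) ≡ (c + a) + b
  rotate = solve-∀

  expansion : (x + y) ^ p ≡ (x ^ p + y ^ p) + sum innerTerm
  expansion = begin
    (x + y) ^ p
      ≡⟨ ^′≡^ (x + y) p ⟨
    (x + y) ^′ p
      ≡⟨ binomialTheorem p x y ⟩
    term Fin.zero + sum (term ∘ Fin.suc)
      ≡⟨ cong (_+_ (term Fin.zero)) (sum-init-last (term ∘ Fin.suc)) ⟩
    term Fin.zero + (sum innerTerm + term (Fin.suc (fromℕ p-1)))
      ≡⟨ rotate (term Fin.zero) (sum innerTerm) (term (Fin.suc (fromℕ p-1))) ⟩
    (term (Fin.suc (fromℕ p-1)) + term Fin.zero) + sum innerTerm
      ≡⟨ cong (_+ sum innerTerm) (cong₂ _+_ lastTerm firstTerm) ⟩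
    (x ^ p + y ^ p) + sum innerTerm
      ∎
    where open ≡-Reasoning

-- Induction on `a`: the p-th power is additive mod `p` and fixes 1. Integers are handled afterwards
-- through their residues.
^p≡id-ℕ : Prime p → ∀ a → (+ a) ^ p ≡ + a [mod p ]
^p≡id-ℕ {zero}  pr a       = contradiction pr ¬prime[0]
^p≡id-ℕ {suc p-1} pr zero    = mod-reflexive (ℤ.*-zeroˡ (0ℤ ^ p-1))
^p≡id-ℕ {p@(suc _)} pr (suc a) =
  mod-trans (^-+-mod pr 1ℤ (+ a))
            (+-mod (mod-reflexive (ℤ.^-zeroˡ p)) (^p≡id-ℕ pr a))

^p≡id : Prime p → ∀ z → z ^ p ≡ z [mod p ]
^p≡id {p} pr z = mod-trans (^-mod p z≡r) (mod-trans (^p≡id-ℕ pr (z %ℕ p)) (mod-sym z≡r))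
  where
  instance _ = prime⇒nonZero pr
  z≡r = ≡%ℕ z p

-- `p` divides `z ^ p - z`, which factors as `z * (z ^ (p ∸ 1) - 1ℤ)`. The two alternatives become
-- the residues 0 and 1 of the criterion.
fermat : Prime p → ∀ z → (+ p ∣ z) ⊎ z ^ (p ∸ 1) ≡ 1ℤ [mod p ]
fermat {zero}        pr z = contradiction pr ¬prime[0]
fermat {p@(suc p-1)} pr z = Sum.map id mod
  (prime∣* pr z (z ^ p-1 - 1ℤ) (subst (+ p ∣_) (factor z (z ^ p-1)) (difference (^p≡id pr z))))
  where
  factor : ∀ z w → z * w - z ≡ z * (w - 1ℤ)
  factor = solve-∀

-- Chinese remainders for two primes

∣⇒∣^ : ∀ k → 0 < k → + m ∣ x → + m ∣ x ^ k
∣⇒∣^ {x = x} (suc k) _ d = ∣m⇒∣m*n (x ^ k) d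

1<prime : Prime p → 1 < p
1<prime {p} pr = ℕ.nonTrivial⇒n>1 p {{prime⇒nonTrivial pr}}

0<prime∸1 : Prime p → 0 < p ∸ 1
0<prime∸1 pr = ℕ.m<n⇒0<n∸m (1<prime pr)

-- By Fermat, p ^ (q - 1) is 0 mod p and 1 mod q, so no Bézout coefficients are needed.
crt : Prime p → Prime q → p ≢ q → ∀ b c → ∃[ x ] x ≡ b [mod p ] × x ≡ c [mod q ]
crt {p} {q} pp pq p≢q b c =
  b + (+ p) ^ (q ∸ 1) * (c - b) ,
  mod-trans (+-mod (mod-refl b) (*-mod p^[q-1]≡0 (mod-refl (c - b)))) (mod-reflexive (at0 b c)) ,
  mod-trans (+-mod (mod-refl b) (*-mod p^[q-1]≡1 (mod-refl (c - b)))) (mod-reflexive (at1 b c))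
  where
  p^[q-1]≡0 : (+ p) ^ (q ∸ 1) ≡ 0ℤ [mod p ]
  p^[q-1]≡0 = ∣⇒≡0 (∣⇒∣^ (q ∸ 1) (0<prime∸1 pq) Signed.∣-refl)

  p^[q-1]≡1 : (+ p) ^ (q ∸ 1) ≡ 1ℤ [mod q ]
  p^[q-1]≡1 = [ (λ q∣p → contradiction (sym (prime∣prime pq pp (∣⇒∣ᵤ q∣p))) p≢q) , id ]′
                (fermat pq (+ p))

  at0 : ∀ b c → b + 0ℤ * (c - b) ≡ b
  at0 = solve-∀

  at1 : ∀ b c → b + 1ℤ * (c - b) ≡ c
  at1 = solve-∀

-- Roots modulo a prime

-- The value at x of l X^n + v, where v lists the n lower coefficients.
evalTop : Vec ℤ n → ℤ → ℤ → ℤ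
evalTop []      l x = l
evalTop (a ∷ v) l x = a + x * evalTop v l x

lc≡0⇒eval≡0 : ∀ f x → lc f ≡ 0ℤ → eval f x ≡ 0ℤ
lc≡0⇒eval≡0 []      x _ = refl
lc≡0⇒eval≡0 (a ∷ f) x e with lc f ℤ.≟ 0ℤ
... | yes lc≡0 = trans (cong₂ (λ a y → a + x * y) e (lc≡0⇒eval≡0 f x lc≡0))
                       (trans (ℤ.+-identityˡ _) (ℤ.*-zeroʳ x))
... | no  lc≢0 = contradiction e lc≢0

-- Drops the trailing zeros and separates the leading coefficient, so that induction on the degree
-- becomes induction on the length of a vector.
lowerCoefficients : ∀ f → Σ[ v ∈ Vec ℤ (deg f) ] (∀ x → eval f x ≡ evalTop v (lc f) x)
lowerCoefficients []      = [] , λ _ → refl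
lowerCoefficients (a ∷ f) with lc f ℤ.≟ 0ℤ
... | yes lc≡0 = [] , λ x →
  trans (cong (λ y → a + x * y) (lc≡0⇒eval≡0 f x lc≡0))
        (trans (cong (_+_ a) (ℤ.*-zeroʳ x)) (ℤ.+-identityʳ a))
... | no  _    with v , e ← lowerCoefficients f = a ∷ v , λ x → cong (λ y → a + x * y) (e x)

-- Synthetic division by X - a, which keeps the leading coefficient l.
quotient : Vec ℤ (suc n) → ℤ → ℤ → Vec ℤ n
quotient (c ∷ [])        l a = []
quotient (c ∷ v@(_ ∷ _)) l a = evalTop v l a ∷ quotient v l a

quotient-correct : ∀ (v : Vec ℤ (suc n)) l a x →
  evalTop v l x - evalTop v l a ≡ (x - a) * evalTop (quotient v l a) l x
quotient-correct (c ∷ []) l a x = linear c l a x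
  where
  linear : ∀ c l a x → c + x * l - (c + a * l) ≡ (x - a) * l
  linear = solve-∀
quotient-correct (c ∷ v@(_ ∷ _)) l a x = begin
  c + x * vx - (c + a * va)                      ≡⟨ split c x vx a va ⟩
  (x - a) * va + x * (vx - va)                   ≡⟨ cong (λ y → (x - a) * va + x * y) (quotient-correct v l a x) ⟩
  (x - a) * va + x * ((x - a) * qx)              ≡⟨ collect x a va qx ⟩
  (x - a) * (va + x * qx)                        ∎
  where
  open ≡-Reasoning
  vx = evalTop v l x
  va = evalTop v l a
  qx = evalTop (quotient v l a) l x
  split : ∀ c x vx a va → c + x * vx - (c + a * va) ≡ (x - a) * va + x * (vx - va)
  split = solve-∀
  collect : ∀ x a va qx → (x - a) * va + x * ((x - a) * qx) ≡ (x - a) * (va + x * qx)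
  collect = solve-∀

-- Induction on `n`, dividing by X - n. The quotient keeps the leading coefficient `l` and still
-- vanishes mod `q` at 0, ..., n - 1, until only the constant `l` is left.
tooManyRoots : Prime q → n < q → (v : Vec ℤ n) (l : ℤ) →
  (∀ i → i ≤ n → + q ∣ evalTop v l (+ i)) → + q ∣ l
tooManyRoots {n = zero}      pq n<q [] l roots = roots 0 z≤n
tooManyRoots {q} {n = n@(suc n-1)} pq n<q v l roots =
  tooManyRoots pq (ℕ.<-trans (ℕ.n<1+n n-1) n<q) (quotient v l (+ n)) l quotientRoots
  where
  quotientRoots : ∀ i → i ≤ n-1 → + q ∣ evalTop (quotient v l (+ n)) l (+ i)
  quotientRoots i i≤n-1
    with prime∣* pq (+ i - + n) _ (subst (+ q ∣_) (quotient-correct v l (+ n) (+ i))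
           (∣m∣n⇒∣m-n (roots i (ℕ.<⇒≤ (s≤s i≤n-1))) (roots n ℕ.≤-refl)))
  -- `i` and `n` are distinct and both below `q`, so they cannot agree mod `q`.
  ... | inj₁ q∣i-n = contradiction
        (distinctResidues (ℕ.<-trans (s≤s i≤n-1) n<q) n<q (mod q∣i-n))
        (ℕ.<⇒≢ (s≤s i≤n-1))
  ... | inj₂ q∣Q   = q∣Q

vanishing⇒∣lc : Prime q → ∀ f → deg f < q → (∀ i → + q ∣ eval f (+ i)) → + q ∣ lc f
vanishing⇒∣lc {q} pq f deg<q roots with v , e ← lowerCoefficients f =
  tooManyRoots pq deg<q v (lc f) λ i _ → subst (+ q ∣_) (e (+ i)) (roots i)

-- The primality criterion

vanishesMod : ∀ N .{{_ : NonZero N}} f b → + N ∣ eval f b →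
  (∀ x → x < N → (eval f (+ x) ^ (N ∸ 1)) %ℕ N ≡ 0 ⊎ (eval f (+ x) ^ (N ∸ 1)) %ℕ N ≡ 1) →
  Prime p → p ℕ∣.∣ N → Prime q → q ℕ∣.∣ N → p ≢ q → ∀ c → + q ∣ eval f c
vanishesMod {p} {q} N f b N∣fb residues pp p∣N pq q∣N p≢q c
  with x , x≡b , x≡c ← crt pp pq p≢q b c = conclude (residues r (n%ℕd<d x N))
  where
  -- The residue condition covers only arguments below `N`, so `x` is reduced mod `N`; as `p` and
  -- `q` divide `N`, this preserves both congruences.
  r = x %ℕ N
  fr = eval f (+ r)

  p∣fr : + p ∣ fr
  p∣fr = ≡0⇒∣ (mod-trans (eval-mod f (mod-trans (mod-sym (mod-∣ p∣N (≡%ℕ x N))) x≡b))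
                        (∣⇒≡0 (∣-trans (∣ᵤ⇒∣ p∣N) N∣fb)))

  -- With a positive exponent, `p ∣ fr` passes to the power; residue 1 would then make `p` divide 1.
  0<N∸1 : 0 < N ∸ 1
  0<N∸1 = ℕ.<-≤-trans (0<prime∸1 pp) (ℕ.∸-monoˡ-≤ 1 (ℕ∣.∣⇒≤ p∣N))

  fr^≡residue : ∀ {v} → (fr ^ (N ∸ 1)) %ℕ N ≡ v → fr ^ (N ∸ 1) ≡ + v [mod N ]
  fr^≡residue refl = ≡%ℕ (fr ^ (N ∸ 1)) N

  conclude : (fr ^ (N ∸ 1)) %ℕ N ≡ 0 ⊎ (fr ^ (N ∸ 1)) %ℕ N ≡ 1 → + q ∣ eval f c
  conclude (inj₁ e) = ≡0⇒∣ (mod-trans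
    (eval-mod f (mod-trans (mod-sym x≡c) (mod-∣ q∣N (≡%ℕ x N))))
    (∣⇒≡0 (prime∣^ pq fr (N ∸ 1) (≡0⇒∣ (mod-∣ q∣N (fr^≡residue e))))))
  conclude (inj₂ e) = contradiction
    (∣⇒∣ᵤ (≡0⇒∣ (mod-trans (mod-sym (mod-∣ p∣N (fr^≡residue e)))
                           (∣⇒≡0 (∣⇒∣^ (N ∸ 1) 0<N∸1 p∣fr)))))
    (prime∤1 pp)

otherPrimeDivisor : ∀ q → HasTwoDistinctPrimeDivisors n → ∃[ p ] Prime p × p ℕ∣.∣ n × p ≢ q
otherPrimeDivisor q (p , r , pp , pr , p≢r , p∣n , r∣n) with p ℕ.≟ q
... | no  p≢q  = p , pp , p∣n , p≢q
... | yes refl = r , pr , r∣n , p≢r ∘ sym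

theorem5p1 : (N : ℕ) .{{_ : NonZero N}} →
    Odd N →
    Prime N ⊎ HasTwoDistinctPrimeDivisors N →
    (b : ℤ) (f : ℤ[X]) →
    eval f b ≡ + N →
    (q : ℕ) → IsLargestPrimeDivisor q N →
    deg f < q →
    gcd (lc f) (+ N) ≡ 1ℤ →
    Prime N ⇔
    (∀ (x : ℕ) → x < N →
    ((eval f (+ x) ^ (N ∸ 1)) %ℕ N ≡ 0) ⊎ ((eval f (+ x) ^ (N ∸ 1)) %ℕ N ≡ 1))
theorem5p1 N _ primeOrTwo b f fb≡N q (pq , q∣N , _) deg<q gcd≡1 = mk⇔ forward backward
  where
  Residues : Set
  Residues = ∀ x → x < N →
    (eval f (+ x) ^ (N ∸ 1)) %ℕ N ≡ 0 ⊎ (eval f (+ x) ^ (N ∸ 1)) %ℕ N ≡ 1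

  forward : Prime N → Residues
  -- The residues 0 and 1 are read off by uniqueness: both are below `N`, since a prime exceeds 1.
  forward pN x x<N = Sum.map
    (λ N∣y → %ℕ-unique (ℕ.≤-<-trans z≤n x<N) (∣⇒≡0 (∣⇒∣^ (N ∸ 1) (0<prime∸1 pN) N∣y)))
    (%ℕ-unique (1<prime pN))
    (fermat pN (eval f (+ x)))

  twoPrimes : Residues → HasTwoDistinctPrimeDivisors N → Prime N
  twoPrimes residues two with p , pp , p∣N , p≢q ← otherPrimeDivisor q two =
    -- `q` divides both `lc f` and `N`, hence their gcd, which is 1; so this case cannot occur.
    contradiction (subst (λ g → q ℕ∣.∣ ∣ g ∣) gcd≡1 q∣gcd) (prime∤1 pq)
    where
    q∣lc : + q ∣ lc f
    q∣lc = vanishing⇒∣lc pq f deg<q λ i →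
      vanishesMod N f b (subst (+ N ∣_) (sym fb≡N) Signed.∣-refl) residues
        pp p∣N pq q∣N p≢q (+ i)

    q∣gcd = gcd-greatest {lc f} {+ N} {+ q} (∣⇒∣ᵤ q∣lc) q∣N

  backward : Residues → Prime N
  backward residues = [ id , twoPrimes residues ]′ primeOrTwo
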